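{- Let $k,q,t\in\mathbb N$ be positive integers, let $p=\binom{2k+1}{k+1}$, assume $q\ge p+1$, and let $q'=\binom{q}{p}$. Then $$r_{2k+1}\big(\hat H_t^{(2k+1)};q',2\big)>r_{k+1}(t;q,p+1)-1.$$
   Context: $K_n^{(k)}$ is the complete $k$-uniform hypergraph on $n$ vertices. For a $k$-uniform hypergraph $G$ and integers $q\ge p$, $r_k(G;q,p)$ is the smallest integer $n$ such that in every colouring of the edges of $K_n^{(k)}$ with $q$ colours there is a (not necessarily induced) copy of $G$ whose edges receive fewer than $p$ distinct colours in total. We write $r_k(t;q,p)$ for $r_k(K_t^{(k)};q,p)$. The $k$-uniform balanced hedgehog $\hat H_t^{(k)}$ with body of order $t$ is the following $k$-uniform hypergraph: take a set $S$ of $t$ vertices (the body), and for each subset $X\subset S$ with $|X|=\lceil k/2\rceil$ add one $k$-edge $e$ with $e\cap S=X$, in such a way that any two distinct edges $e,f$ satisfy $e\cap f\subset S$. The vertex set consists of $S$ and the vertices of these edges. -}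

module Defs where

open import Data.Fin using (Fin)
open import Data.Fin.Properties using (any?; _≟_)
open import Data.Fin.Subset using (Subset; _∈_; _⊆_; _∩_; ∣_∣)
open import Data.Fin.Subset.Properties using (_∈?_)
open import Data.Nat using (ℕ; _≤_; _<_; ⌈_/2⌉)
import Data.Nat.Properties as ℕ
open import Data.Product using (Σ-syntax; ∃!; ∃-syntax; _×_)
open import Data.Sum using (_⊎_)
open import Data.Vec using (tabulate)
open import Function.Bundles using (_⇔_)
open import Function.Definitions using (Injective)
open import Relation.Binary.PropositionalEquality using (_≡_; _≢_)
open import Relation.Nullary.Decidable using (does; _×-dec_)
open import Relation.Unary using (Decidable)

record Hypergraph (k : ℕ) : Set₁ where
  field
    order   : ℕ
    IsEdge  : Subset order → Set
    isEdge? : Decidable IsEdge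
    uniform : ∀ {e} → IsEdge e → ∣ e ∣ ≡ k

open Hypergraph public

complete : (k n : ℕ) → Hypergraph k
complete k n = record
  { order   = n
  ; IsEdge  = λ e → ∣ e ∣ ≡ k
  ; isEdge? = λ e → ∣ e ∣ ℕ.≟ k
  ; uniform = λ eq → eq
  }

image : ∀ {m n} → (Fin m → Fin n) → Subset m → Subset n
image f e = tabulate λ y → does (any? λ x → (x ∈? e) ×-dec (f x ≟ y))

-- Only edges have to be preserved, so copies need not be induced.
record Copy {k : ℕ} (G H : Hypergraph k) : Set where
  field
    vertex    : Fin (order G) → Fin (order H)
    injective : Injective _≡_ _≡_ vertex
    edge      : ∀ {e} → IsEdge G e → IsEdge H (image vertex e)

open Copy public

Colouring : ∀ {k} → Hypergraph k → ℕ → Set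
Colouring H q = (e : Subset (order H)) → IsEdge H e → Fin q

-- P is exactly the set of colours received by the edges of the copy φ.
IsColourSet : ∀ {k q} {G H : Hypergraph k} →
              Colouring H q → Copy G H → Subset q → Set
IsColourSet {G = G} c φ P =
  ∀ i → i ∈ P ⇔ (∃[ e ] Σ[ h ∈ IsEdge G e ] c (image (vertex φ) e) (edge φ h) ≡ i)

Arrows : ∀ {k} → Hypergraph k → (q p n : ℕ) → Set
Arrows {k} G q p n =
  (c : Colouring (complete k n) q) →
  Σ[ φ ∈ Copy G (complete k n) ] ∃[ P ] IsColourSet c φ P × ∣ P ∣ < p

-- The graph of the function r: n = r_k(G; q, p).
IsRamseyNumber : ∀ {k} → Hypergraph k → (q p n : ℕ) → Set
IsRamseyNumber G q p n = Arrows G q p n × (∀ m → Arrows G q p m → n ≤ m)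

-- These conditions determine the balanced hedgehog with body of order t up to
-- isomorphism.
record IsBalancedHedgehog {k : ℕ} (t : ℕ) (G : Hypergraph k) : Set where
  field
    body       : Subset (order G)
    body-order : ∣ body ∣ ≡ t
    edge-trace : ∀ {e} → IsEdge G e → ∣ e ∩ body ∣ ≡ ⌈ k /2⌉
    trace-edge : ∀ {X} → X ⊆ body → ∣ X ∣ ≡ ⌈ k /2⌉ →
                 ∃! _≡_ λ e → IsEdge G e × e ∩ body ≡ X
    separated  : ∀ {e f} → IsEdge G e → IsEdge G f → e ≢ f → e ∩ f ⊆ body
    spanned    : ∀ v → v ∈ body ⊎ (∃[ e ] IsEdge G e × v ∈ e)

{-# OPTIONS --safe #-}
-- Write s = k + 1, so that a (2k+1)-set has p = C(2k+1, s) subsets of size s.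
-- Given a q-colouring of the s-subsets of the vertex set, colour a (2k+1)-set
-- by some p-set of colours (its palette) containing the colours of all its
-- s-subsets. In a monochromatic hedgehog all edges share one palette, and every
-- s-subset of the body lies in an edge, so the body spans a clique whose colours
-- all lie in that palette.
module Submission where

open import Data.Bool using (true)
open import Data.Fin using (Fin; zero; suc; fromℕ<)
import Data.Fin as Fin
open import Data.Fin.Properties using (any?; suc-injective)
open import Data.Fin.Subset
open import Data.Fin.Subset.Properties
open import Data.List using (List; []; _∷_; _++_; map; length; lookup)
open import Data.List.Membership.Propositional using () renaming (_∈_ to _∈ˡ_)
open import Data.List.Membership.Propositional.Properties using (∈-map⁺; ∈-++⁺ˡ; ∈-++⁺ʳ)
open import Data.List.Properties using (length-++; length-map)
open import Data.List.Relation.Unary.Any using (here; there; index)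
open import Data.List.Relation.Unary.Any.Properties using (lookup-index)
open import Data.Nat using (ℕ; zero; suc; _+_; _*_; _∸_; _≤_; _<_; _≥_; _>_; z≤n; s≤s; ⌈_/2⌉)
open import Data.Nat.Combinatorics using (_C_; nCk+nC[k+1]≡[n+1]C[k+1])
open import Data.Nat.Properties
  using (≤-trans; ≤-reflexive; ≤-antisym; ≡-irrelevant; <⇒≤; <⇒≱;
         m≤n⇒m<n∨m≡n; ∸-monoˡ-≤; +-comm; +-suc; _≟_; module ≤-Reasoning)
open import Data.Product using (Σ-syntax; ∃-syntax; _×_; _,_; proj₁; proj₂)
open import Data.Sum using (inj₁; inj₂)
open import Data.Vec using (tabulate; []; _∷_; here; there)
open import Data.Vec.Properties using (lookup∘tabulate; []=⇒lookup; lookup⇒[]=)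
open import Function using (_∘_; mk⇔)
open import Function.Bundles using (Equivalence)
open import Function.Definitions using (Injective)
open import Relation.Binary.PropositionalEquality
  using (_≡_; refl; sym; trans; cong; cong₂; subst; module ≡-Reasoning)
open import Relation.Binary.PropositionalEquality.Properties using (subst-injective)
open import Relation.Nullary using (Dec; yes; no; contradiction)
open import Relation.Nullary.Decidable using (does; dec-true; decidable-stable; _×-dec_)
open import Relation.Unary using (Pred; Decidable)
open import Defs

-- Finite subsets: membership, cardinality, enumeration

does⇒ : ∀ {a} {A : Set a} (a? : Dec A) → does a? ≡ true → A
does⇒ (yes a) _ = a

∈-tabulate⁺ : ∀ {n ℓ} {P : Pred (Fin n) ℓ} (P? : Decidable P) {x} →
              P x → x ∈ tabulate (does ∘ P?)
∈-tabulate⁺ P? {x} px =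
  lookup⇒[]= x _ (trans (lookup∘tabulate (does ∘ P?) x) (dec-true (P? x) px))

∈-tabulate⁻ : ∀ {n ℓ} {P : Pred (Fin n) ℓ} (P? : Decidable P) {x} →
              x ∈ tabulate (does ∘ P?) → P x
∈-tabulate⁻ P? {x} x∈ =
  does⇒ (P? x) (trans (sym (lookup∘tabulate (does ∘ P?) x)) ([]=⇒lookup x∈))

∣⁅x⁆∪p∣≤1+∣p∣ : ∀ {n} (x : Fin n) (p : Subset n) → ∣ ⁅ x ⁆ ∪ p ∣ ≤ suc ∣ p ∣
∣⁅x⁆∪p∣≤1+∣p∣ zero    (s ∷ p) rewrite ∪-identityˡ p = s≤s (∣p∣≤∣x∷p∣ s p)
∣⁅x⁆∪p∣≤1+∣p∣ (suc x) (outside ∷ p) = ∣⁅x⁆∪p∣≤1+∣p∣ x p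
∣⁅x⁆∪p∣≤1+∣p∣ (suc x) (inside  ∷ p) = s≤s (∣⁅x⁆∪p∣≤1+∣p∣ x p)

-- If `x` and `y` differed, `x` would survive in `p - y`, giving `p` at least two elements.
∣p∣<2⇒x≡y : ∀ {n} {p : Subset n} {x y} → ∣ p ∣ < 2 → x ∈ p → y ∈ p → x ≡ y
∣p∣<2⇒x≡y {p = p} {x} {y} ∣p∣<2 x∈p y∈p = decidable-stable (x Fin.≟ y) λ x≢y →
  <⇒≱ ∣p∣<2 (begin
    2               ≡⟨ cong suc (∣⁅x⁆∣≡1 x) ⟨
    suc ∣ ⁅ x ⁆ ∣   ≤⟨ s≤s (p⊆q⇒∣p∣≤∣q∣ λ z∈ →
                         subst (_∈ p - y) (sym (x∈⁅y⁆⇒x≡y x z∈)) (x∈p∧x≢y⇒x∈p-y x∈p x≢y)) ⟩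
    suc ∣ p - y ∣   ≤⟨ x∈p⇒∣p-x∣<∣p∣ y∈p ⟩
    ∣ p ∣           ∎)
  where open ≤-Reasoning

-- Lets a size bound be proved from a witness in `p`: below, a colour of the clique is what yields
-- an edge of the hedgehog.
nonempty-bounded : ∀ {n m} (p : Subset n) → (∀ {x} → x ∈ p → ∣ p ∣ ≤ m) → ∣ p ∣ ≤ m
nonempty-bounded {n} p bound with nonempty? p
... | yes (_ , x∈p) = bound x∈p
... | no p-empty    =
  ≤-trans (≤-reflexive (trans (cong ∣_∣ (Empty-unique p-empty)) (∣⊥∣≡0 n))) z≤n

enlarge : ∀ {n} (A : Subset n) {p} → ∣ A ∣ ≤ p → p ≤ n → ∃[ B ] A ⊆ B × ∣ B ∣ ≡ p
enlarge []            ∣A∣≤p       z≤n       = [] , (λ ()) , refl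
enlarge (inside ∷ A)  (s≤s ∣A∣≤p) (s≤s p≤n) with enlarge A ∣A∣≤p p≤n
... | B , A⊆B , ∣B∣≡p = inside ∷ B , in⊆in A⊆B , cong suc ∣B∣≡p
enlarge {suc n} (outside ∷ A) ∣A∣≤p p≤1+n with m≤n⇒m<n∨m≡n p≤1+n
-- When `p` is the full `suc n`, only `⊤` is large enough; otherwise the head can stay outside.
... | inj₂ refl      = ⊤ , ⊆⊤ , ∣⊤∣≡n (suc n)
... | inj₁ (s≤s p≤n) with enlarge A ∣A∣≤p p≤n
...   | B , A⊆B , ∣B∣≡p = outside ∷ B , out⊆ A⊆B , ∣B∣≡p

-- Embeds the vertex set `Fin ∣ p ∣` of a clique onto a body given as a subset.
enumerate : ∀ {n} (p : Subset n) →
            Σ[ f ∈ (Fin ∣ p ∣ → Fin n) ] Injective _≡_ _≡_ f × (∀ i → f i ∈ p)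
enumerate []            = (λ ()) , (λ { {()} }) , λ ()
enumerate (outside ∷ p) with enumerate p
... | f , f-inj , f∈p = suc ∘ f , f-inj ∘ suc-injective , there ∘ f∈p
enumerate {suc n} (inside ∷ p) with enumerate p
... | f , f-inj , f∈p = g , g-inj , g∈
  where
  g : Fin (suc ∣ p ∣) → Fin (suc n)
  g zero    = zero
  g (suc i) = suc (f i)

  g-inj : Injective _≡_ _≡_ g
  g-inj {zero}  {zero}  _  = refl
  g-inj {suc i} {suc j} eq = cong suc (f-inj (suc-injective eq))

  g∈ : ∀ i → g i ∈ inside ∷ p
  g∈ zero    = here
  g∈ (suc i) = there (f∈p i)

-- Images of subsets

∈-image⁺ : ∀ {m n} (f : Fin m → Fin n) {X x} → x ∈ X → f x ∈ image f X
∈-image⁺ f {X} x∈X =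
  ∈-tabulate⁺ (λ y → any? λ x → (x ∈? X) ×-dec (f x Fin.≟ y)) (_ , x∈X , refl)

∈-image⁻ : ∀ {m n} (f : Fin m → Fin n) X {y} → y ∈ image f X → ∃[ x ] x ∈ X × f x ≡ y
∈-image⁻ f X = ∈-tabulate⁻ (λ y → any? λ x → (x ∈? X) ×-dec (f x Fin.≟ y))

image-∘-⊆ : ∀ {l m n} (g : Fin m → Fin n) (f : Fin l → Fin m) X Y →
            image f X ⊆ Y → image (g ∘ f) X ⊆ image g Y
image-∘-⊆ g f X Y fX⊆Y y∈ with ∈-image⁻ (g ∘ f) X y∈
... | _ , x∈X , refl = ∈-image⁺ g (fX⊆Y (∈-image⁺ f x∈X))

∣image∣≤ : ∀ {m n} (f : Fin m → Fin n) X → ∣ image f X ∣ ≤ ∣ X ∣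
∣image∣≤ {n = n} f [] = ≤-trans (p⊆q⇒∣p∣≤∣q∣ image⊆⊥) (≤-reflexive (∣⊥∣≡0 n))
  where
  image⊆⊥ : image f [] ⊆ ⊥
  image⊆⊥ y∈ with () ← ∈-image⁻ f [] y∈
∣image∣≤ f (outside ∷ X) = ≤-trans (p⊆q⇒∣p∣≤∣q∣ image⊆) (∣image∣≤ (f ∘ suc) X)
  where
  image⊆ : image f (outside ∷ X) ⊆ image (f ∘ suc) X
  image⊆ y∈ with ∈-image⁻ f (outside ∷ X) y∈
  ... | suc _ , there x∈X , refl = ∈-image⁺ (f ∘ suc) x∈X
∣image∣≤ f (inside ∷ X) = begin
  ∣ image f (inside ∷ X) ∣               ≤⟨ p⊆q⇒∣p∣≤∣q∣ image⊆ ⟩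
  ∣ ⁅ f zero ⁆ ∪ image (f ∘ suc) X ∣     ≤⟨ ∣⁅x⁆∪p∣≤1+∣p∣ (f zero) _ ⟩
  suc ∣ image (f ∘ suc) X ∣              ≤⟨ s≤s (∣image∣≤ (f ∘ suc) X) ⟩
  suc ∣ X ∣                              ∎
  where
  open ≤-Reasoning
  image⊆ : image f (inside ∷ X) ⊆ ⁅ f zero ⁆ ∪ image (f ∘ suc) X
  image⊆ y∈ with ∈-image⁻ f (inside ∷ X) y∈
  ... | zero  , _         , refl = x∈p∪q⁺ (inj₁ (x∈⁅x⁆ (f zero)))
  ... | suc _ , there x∈X , refl = x∈p∪q⁺ (inj₂ (∈-image⁺ (f ∘ suc) x∈X))

-- By injectivity `f zero` lies outside the image of the tail, so an inside head makes the inclusion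
-- of that image strict.
∣image∣≥ : ∀ {m n} (f : Fin m → Fin n) → Injective _≡_ _≡_ f → ∀ X → ∣ X ∣ ≤ ∣ image f X ∣
∣image∣≥ f f-inj []            = z≤n
∣image∣≥ f f-inj (s ∷ X) with ∣image∣≥ (f ∘ suc) (suc-injective ∘ f-inj) X
  | (λ {y} → image-∘-⊆ f suc X (s ∷ X) suc⊆ {y})
  where
  suc⊆ : image suc X ⊆ s ∷ X
  suc⊆ y∈ with ∈-image⁻ suc X y∈
  ... | _ , x∈X , refl = there x∈X
∣image∣≥ f f-inj (outside ∷ X) | ih | image⊆ = ≤-trans ih (p⊆q⇒∣p∣≤∣q∣ image⊆)
∣image∣≥ f f-inj (inside ∷ X)  | ih | image⊆ =
  ≤-trans (s≤s ih) (p⊂q⇒∣p∣<∣q∣ (image⊆ , f zero , ∈-image⁺ f here , f0∉))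
  where
  f0∉ : f zero ∉ image (f ∘ suc) X
  f0∉ f0∈ with ∈-image⁻ (f ∘ suc) X f0∈
  ... | _ , _ , eq with () ← f-inj eq

∣image∣ : ∀ {m n} (f : Fin m → Fin n) → Injective _≡_ _≡_ f → ∀ X → ∣ image f X ∣ ≡ ∣ X ∣
∣image∣ f f-inj X = ≤-antisym (∣image∣≤ f X) (∣image∣≥ f f-inj X)

-- Subsets of a given size

-- The recursion is Pascal's rule: subsets using the first element of `p` come before those avoiding
-- it.
combinations : ∀ {n} → Subset n → ℕ → List (Subset n)
combinations []            zero    = [] ∷ []
combinations []            (suc j) = []
combinations (outside ∷ p) j       = map (outside ∷_) (combinations p j)
combinations (inside ∷ p)  zero    = map (outside ∷_) (combinations p zero)
combinations (inside ∷ p)  (suc j) =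
  map (inside ∷_) (combinations p j) ++ map (outside ∷_) (combinations p (suc j))

length-combinations : ∀ {n} (p : Subset n) j → length (combinations p j) ≡ ∣ p ∣ C j
length-combinations []            zero    = refl
length-combinations []            (suc j) = refl
length-combinations (outside ∷ p) j       =
  trans (length-map _ (combinations p j)) (length-combinations p j)
length-combinations (inside ∷ p)  zero    =
  trans (length-map _ (combinations p zero)) (length-combinations p zero)
length-combinations (inside ∷ p)  (suc j) = begin
  length (map (inside ∷_) (combinations p j) ++ map (outside ∷_) (combinations p (suc j)))
    ≡⟨ length-++ (map (inside ∷_) (combinations p j)) ⟩
  length (map (inside ∷_) (combinations p j)) + length (map (outside ∷_) (combinations p (suc j)))
    ≡⟨ cong₂ _+_ (length-map _ (combinations p j)) (length-map _ (combinations p (suc j))) ⟩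
  length (combinations p j) + length (combinations p (suc j))
    ≡⟨ cong₂ _+_ (length-combinations p j) (length-combinations p (suc j)) ⟩
  ∣ p ∣ C j + ∣ p ∣ C suc j
    ≡⟨ nCk+nC[k+1]≡[n+1]C[k+1] ∣ p ∣ j ⟩
  suc ∣ p ∣ C suc j ∎
  where open ≡-Reasoning

∈-combinations : ∀ {n} (p : Subset n) {X j} → X ⊆ p → ∣ X ∣ ≡ j → X ∈ˡ combinations p j
∈-combinations []            {[]}          X⊆p refl = here refl
-- Here `X` contains `zero`, so `X⊆p` forces `s` to be inside.
∈-combinations (s ∷ p)       {inside ∷ X}  X⊆p refl with here ← X⊆p here =
  ∈-++⁺ˡ (∈-map⁺ (inside ∷_) (∈-combinations p (drop-∷-⊆ X⊆p) refl))
∈-combinations (outside ∷ p) {outside ∷ X} X⊆p eq =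
  ∈-map⁺ (outside ∷_) (∈-combinations p (drop-∷-⊆ X⊆p) eq)
∈-combinations (inside ∷ p)  {outside ∷ X} {zero}  X⊆p eq =
  ∈-map⁺ (outside ∷_) (∈-combinations p (λ x∈X → drop-there (X⊆p (there x∈X))) eq)
∈-combinations (inside ∷ p)  {outside ∷ X} {suc j} X⊆p eq =
  ∈-++⁺ʳ (map (inside ∷_) (combinations p j))
    (∈-map⁺ (outside ∷_) (∈-combinations p (λ x∈X → drop-there (X⊆p (there x∈X))) eq))

length-combinations-⊤ : ∀ n p → length (combinations (⊤ {n}) p) ≡ n C p
length-combinations-⊤ n p =
  trans (length-combinations (⊤ {n}) p) (cong (_C p) (∣⊤∣≡n n))

-- Codes a set by its position among all sets of its size, so that palettes can serve as colours.
rank : ∀ {n p} (X : Subset n) → ∣ X ∣ ≡ p → Fin (n C p)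
rank {n} {p} X ∣X∣≡p =
  subst Fin (length-combinations-⊤ n p) (index (∈-combinations ⊤ (⊆⊤ {p = X}) ∣X∣≡p))

-- Looking up the list at the common position returns both sets.
rank-injective : ∀ {n p} {X Y : Subset n} (∣X∣≡p : ∣ X ∣ ≡ p) (∣Y∣≡p : ∣ Y ∣ ≡ p) →
                 rank X ∣X∣≡p ≡ rank Y ∣Y∣≡p → X ≡ Y
rank-injective {n} {p} ∣X∣≡p ∣Y∣≡p eq =
  trans (lookup-index (∈-combinations ⊤ ⊆⊤ ∣X∣≡p))
    (trans (cong (lookup (combinations ⊤ p)) (subst-injective (length-combinations-⊤ n p) eq))
      (sym (lookup-index (∈-combinations ⊤ ⊆⊤ ∣Y∣≡p))))

-- Palettes and colour sets

∣⋃⁅⁆∣≤length : ∀ {a n} {A : Set a} (f : A → Fin n) xs →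
               ∣ ⋃ (map (⁅_⁆ ∘ f) xs) ∣ ≤ length xs
∣⋃⁅⁆∣≤length {n = n} f []       = ≤-reflexive (∣⊥∣≡0 n)
∣⋃⁅⁆∣≤length         f (x ∷ xs) =
  ≤-trans (∣⁅x⁆∪p∣≤1+∣p∣ (f x) _) (s≤s (∣⋃⁅⁆∣≤length f xs))

∈-⋃⁅⁆ : ∀ {a n} {A : Set a} (f : A → Fin n) {x xs} → x ∈ˡ xs → f x ∈ ⋃ (map (⁅_⁆ ∘ f) xs)
∈-⋃⁅⁆ f (here refl)  = x∈p∪q⁺ (inj₁ (x∈⁅x⁆ _))
∈-⋃⁅⁆ f (there x∈xs) = x∈p∪q⁺ (inj₂ (∈-⋃⁅⁆ f x∈xs))

-- At most `r C s` colours occur on the `s`-subsets of `e`, and `r C s ≤ q` leaves room for padding.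
-- The exact size is what allows `rank` to be applied.
palette : ∀ {n q r s} (f : Subset n → Fin q) → r C s ≤ q → (e : Subset n) → ∣ e ∣ ≡ r →
          ∃[ B ] ∣ B ∣ ≡ r C s × (∀ {X} → X ⊆ e → ∣ X ∣ ≡ s → f X ∈ B)
palette {s = s} f p≤q e refl =
  let A = ⋃ (map (⁅_⁆ ∘ f) (combinations e s))
      (B , A⊆B , ∣B∣≡p) = enlarge A (≤-trans (∣⋃⁅⁆∣≤length f (combinations e s))
                                             (≤-reflexive (length-combinations e s))) p≤q
  in B , ∣B∣≡p , λ X⊆e ∣X∣≡s → A⊆B (∈-⋃⁅⁆ f (∈-combinations e X⊆e ∣X∣≡s))

-- A total function can be mapped over lists of subsets without carrying size proofs; `i₀` is a
-- dummy value on sets that are not edges.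
extend : ∀ {s n q} → Colouring (complete s n) q → Fin q → Subset n → Fin q
extend {s} c i₀ X with ∣ X ∣ ≟ s
... | yes h = c X h
... | no  _ = i₀

extend-≡ : ∀ {s n q} (c : Colouring (complete s n) q) i₀ {X} h → extend c i₀ X ≡ c X h
extend-≡ {s} c i₀ {X} h with ∣ X ∣ ≟ s
... | yes h′ = cong (c X) (≡-irrelevant h′ h)
... | no  ¬h = contradiction h ¬h

-- Exhaustive search over the finitely many subsets; this decision turns the colours that occur into
-- a `Subset`.
hasColour? : ∀ {n q} s (f : Subset n → Fin q) → Decidable λ i → ∃[ X ] ∣ X ∣ ≡ s × f X ≡ i
hasColour? s f i = anySubset? λ X → (∣ X ∣ ≟ s) ×-dec (f X Fin.≟ i)

colours : ∀ {n q} → ℕ → (Subset n → Fin q) → Subset q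
colours s f = tabulate (does ∘ hasColour? s f)

∈-colours⁺ : ∀ {n q} s (f : Subset n → Fin q) {i} →
             ∃[ X ] ∣ X ∣ ≡ s × f X ≡ i → i ∈ colours s f
∈-colours⁺ s f = ∈-tabulate⁺ (hasColour? s f)

∈-colours⁻ : ∀ {n q} s (f : Subset n → Fin q) {i} →
             i ∈ colours s f → ∃[ X ] ∣ X ∣ ≡ s × f X ≡ i
∈-colours⁻ s f = ∈-tabulate⁻ (hasColour? s f)

-- From hedgehogs to cliques

hedgehog-arrows⇒clique-arrows :
  ∀ {r t q m} (Ĥ : Hypergraph r) → IsBalancedHedgehog t Ĥ →
  let s = ⌈ r /2⌉ ; p = r C s in p < q →
  Arrows Ĥ (q C p) 2 m → Arrows (complete s t) q (suc p) m
hedgehog-arrows⇒clique-arrows {r} {t} {q} {m} Ĥ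
  -- Matching `body-order` with `refl` turns `t` into `∣ S ∣`, so the clique can be placed on the
  -- enumerated body.
  record { body = S ; body-order = refl ; trace-edge = trace-edge } p<q arrows c =
  clique , P , P-colours , s≤s ∣P∣≤p
  where
  s = ⌈ r /2⌉
  p = r C s

  c⁺ : Subset m → Fin q
  c⁺ = extend c (fromℕ< p<q)

  paletteOf : (e : Subset m) → ∣ e ∣ ≡ r →
              ∃[ B ] ∣ B ∣ ≡ p × (∀ {X} → X ⊆ e → ∣ X ∣ ≡ s → c⁺ X ∈ B)
  paletteOf = palette c⁺ (<⇒≤ p<q)

  paletteColouring : Colouring (complete r m) (q C p)
  paletteColouring e h = rank (proj₁ (paletteOf e h)) (proj₁ (proj₂ (paletteOf e h)))

  hedgehog : Copy Ĥ (complete r m)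
  hedgehog = proj₁ (arrows paletteColouring)

  φ : Fin (order Ĥ) → Fin m
  φ = vertex hedgehog

  edgePalette : ∀ {e} → IsEdge Ĥ e → Subset q
  edgePalette {e} h = proj₁ (paletteOf (image φ e) (edge hedgehog h))

  ∣edgePalette∣ : ∀ {e} (h : IsEdge Ĥ e) → ∣ edgePalette h ∣ ≡ p
  ∣edgePalette∣ {e} h = proj₁ (proj₂ (paletteOf (image φ e) (edge hedgehog h)))

  -- Fewer than two colours on the copy force equal ranks, and `rank` is injective.
  edgePalette-unique : ∀ {e f} (h : IsEdge Ĥ e) (h′ : IsEdge Ĥ f) →
                       edgePalette h ≡ edgePalette h′
  edgePalette-unique h h′ =
    let (Q , Q-colours , ∣Q∣<2) = proj₂ (arrows paletteColouring)
        colour∈Q : ∀ {e} (h : IsEdge Ĥ e) → paletteColouring (image φ e) (edge hedgehog h) ∈ Q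
        colour∈Q h = Equivalence.from (Q-colours _) (_ , h , refl)
    in rank-injective (∣edgePalette∣ h) (∣edgePalette∣ h′) (∣p∣<2⇒x≡y ∣Q∣<2 (colour∈Q h) (colour∈Q h′))

  ι : Fin ∣ S ∣ → Fin (order Ĥ)
  ι = proj₁ (enumerate S)

  ι-injective : Injective _≡_ _≡_ ι
  ι-injective = proj₁ (proj₂ (enumerate S))

  image-ι⊆S : ∀ X → image ι X ⊆ S
  image-ι⊆S X y∈ with ∈-image⁻ ι X y∈
  ... | x , _ , refl = proj₂ (proj₂ (enumerate S)) x

  ψ-injective : Injective _≡_ _≡_ (φ ∘ ι)
  ψ-injective = ι-injective ∘ injective hedgehog

  clique : Copy (complete s ∣ S ∣) (complete s m)
  clique = record
    { vertex    = φ ∘ ι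
    ; injective = ψ-injective
    ; edge      = λ {X} ∣X∣≡s → trans (∣image∣ (φ ∘ ι) ψ-injective X) ∣X∣≡s
    }

  -- `trace-edge` extends the copy of `X` in the body to a hedgehog edge `e`; the image of `X` is
  -- then an `s`-subset of the image of `e`, whose palette holds its colour.
  colour∈edgePalette : ∀ X → ∣ X ∣ ≡ s →
                       ∃[ e ] Σ[ h ∈ IsEdge Ĥ e ] c⁺ (image (φ ∘ ι) X) ∈ edgePalette h
  colour∈edgePalette X ∣X∣≡s
    with trace-edge (image-ι⊆S X) (trans (∣image∣ ι ι-injective X) ∣X∣≡s)
  ... | e , (h , e∩S≡ιX) , _ =
    e , h , proj₂ (proj₂ (paletteOf (image φ e) (edge hedgehog h)))
              {image (φ ∘ ι) X} (image-∘-⊆ φ ι X e ιX⊆e) (edge clique ∣X∣≡s)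
    where
    ιX⊆e : image ι X ⊆ e
    ιX⊆e {y} y∈ = p∩q⊆p e S (subst (y ∈_) (sym e∩S≡ιX) y∈)

  f : Subset t → Fin q
  f X = c⁺ (image (φ ∘ ι) X)

  f-≡ : ∀ X (h : ∣ X ∣ ≡ s) → f X ≡ c (image (φ ∘ ι) X) (edge clique h)
  f-≡ X h = extend-≡ c _ {image (φ ∘ ι) X} (edge clique h)

  P : Subset q
  P = colours s f

  P-colours : IsColourSet c clique P
  P-colours i = mk⇔
    ((λ (X , h , eq) → X , h , trans (sym (f-≡ X h)) eq) ∘ ∈-colours⁻ s f)
    (∈-colours⁺ s f ∘ λ (X , h , eq) → X , h , trans (f-≡ X h) eq)

  f∈edgePalette : ∀ {e} (h : IsEdge Ĥ e) X → ∣ X ∣ ≡ s → f X ∈ edgePalette h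
  f∈edgePalette h X ∣X∣≡s with colour∈edgePalette X ∣X∣≡s
  ... | _ , h′ , fX∈ = subst (f X ∈_) (edgePalette-unique h′ h) fX∈

  P⊆edgePalette : ∀ {e} (h : IsEdge Ĥ e) → P ⊆ edgePalette h
  P⊆edgePalette h = in-palette ∘ ∈-colours⁻ s f
    where
    in-palette : ∀ {i} → ∃[ X ] ∣ X ∣ ≡ s × f X ≡ i → i ∈ edgePalette h
    in-palette (X , ∣X∣≡s , refl) = f∈edgePalette h X ∣X∣≡s

  edge⇒∣P∣≤p : ∀ {e} → IsEdge Ĥ e → ∣ P ∣ ≤ p
  edge⇒∣P∣≤p h = ≤-trans (p⊆q⇒∣p∣≤∣q∣ (P⊆edgePalette h)) (≤-reflexive (∣edgePalette∣ h))

  -- If t < s there is no edge to supply a palette, but then P is empty.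
  ∣P∣≤p : ∣ P ∣ ≤ p
  ∣P∣≤p = nonempty-bounded P (bound ∘ ∈-colours⁻ s f)
    where
    bound : ∀ {i} → ∃[ X ] ∣ X ∣ ≡ s × f X ≡ i → ∣ P ∣ ≤ p
    bound (X , ∣X∣≡s , _) = edge⇒∣P∣≤p (proj₁ (proj₂ (colour∈edgePalette X ∣X∣≡s)))

-- Comparison of the Ramsey numbers

⌈2k+1/2⌉≡k+1 : ∀ k → ⌈ 2 * k + 1 /2⌉ ≡ k + 1
⌈2k+1/2⌉≡k+1 zero    = refl
-- Moving the inner successor outward exposes two of them, which `⌈_/2⌉` trades for one.
⌈2k+1/2⌉≡k+1 (suc k) rewrite +-suc k (k + 0) = cong suc (⌈2k+1/2⌉≡k+1 k)

lemma1p6 : (k q t : ℕ) → 1 ≤ k → 1 ≤ q → 1 ≤ t →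
    let p  = (2 * k + 1) C (k + 1)
        q′ = q C p
    in q ≥ p + 1 →
    (Ĥ : Hypergraph (2 * k + 1)) → IsBalancedHedgehog t Ĥ →
    (m n : ℕ) →
    IsRamseyNumber Ĥ q′ 2 m →
    IsRamseyNumber (complete (k + 1) t) q (p + 1) n →
    m > n ∸ 1
lemma1p6 k q t _ 1≤q 1≤t q≥p+1 Ĥ isHedgehog m n (m-arrows , _) (_ , n-least) =
  -- Minimality gives `n ≤ m`; since `∸` truncates at zero, `n ∸ 1 < m` also needs `m` positive. A
  -- constant colouring, available as `1 ≤ q`, yields a copy of the clique, and `1 ≤ t` gives it a
  -- vertex in `Fin m`.
  n∸1<m (vertex (proj₁ (clique-arrows λ _ _ → fromℕ< 1≤q)) (fromℕ< 1≤t)) (n-least m clique-arrows)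
  where
  clique-arrows : Arrows (complete (k + 1) t) q ((2 * k + 1) C (k + 1) + 1) m
  clique-arrows =
    -- The whole implication is transported, so `⌈ 2 * k + 1 /2⌉` becomes `k + 1` in hypotheses and
    -- conclusion at once. The inner transport turns `1 + p` into `p + 1`.
    subst (λ s → let p = (2 * k + 1) C s in
                 p + 1 ≤ q → Arrows Ĥ (q C p) 2 m → Arrows (complete s t) q (p + 1) m)
      (⌈2k+1/2⌉≡k+1 k)
      (let p = (2 * k + 1) C ⌈ 2 * k + 1 /2⌉ in
       subst (λ p+1 → p+1 ≤ q → Arrows Ĥ (q C p) 2 m →
                      Arrows (complete ⌈ 2 * k + 1 /2⌉ t) q p+1 m)
         (+-comm 1 p) (hedgehog-arrows⇒clique-arrows Ĥ isHedgehog))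
      q≥p+1 m-arrows

  n∸1<m : ∀ {m n} → Fin m → n ≤ m → n ∸ 1 < m
  n∸1<m {suc m} _ n≤m = s≤s (∸-monoˡ-≤ 1 n≤m)
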